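{- (1) Let $V$ be a finite set of propositional variables and $\mathcal{F}=(V,\Gamma,O_1,\dots,O_n)$ a knowledge structure. For every state $s$ of $\mathcal{F}$ and every formula $\alpha\in PAL_n$ over $V$, we have $(\mathcal{F},s)\models\alpha$ iff $(M(\mathcal{F}),s)\models\alpha$. (2) Let $V$ be a finite set of propositional variables. For every finite $S5_n$ Kripke structure $M$ with propositional variable set $V$ and every possible world $w$ of $M$, there are a knowledge structure $\mathcal{F}_M$ with $n$ agents (on a finite set of propositional variables containing $V$) and a state $s_w$ of $\mathcal{F}_M$ such that, for every formula $\alpha\in PAL_n$ over $V$, we have $(\mathcal{F}_M,s_w)\models\alpha$ iff $(M,w)\models\alpha$.
   Context: Formulas of public announcement logic $PAL_n$ over $V$ are given by $\varphi::=p\mid\neg\varphi\mid\varphi\wedge\psi\mid K_i\varphi\mid C_\Delta\varphi\mid[\varphi]\psi$ with $p\in V$, $i\in\{1,\dots,n\}$, $\Delta\subseteq\{1,\dots,n\}$. Kripke semantics. A Kripke structure is $M=(W,\pi,\mathcal{K}_1,\dots,\mathcal{K}_n)$ with $W$ a set of worlds, $\pi(w)$ a truth assignment to the propositional variables for each $w\in W$, and $\mathcal{K}_i$ binary relations on $W$. It is $S5_n$ if all $\mathcal{K}_i$ are equivalence relations, and finite if $W$ is finite. $(M,w)\models p$ iff $\pi(w)(p)=\mathbf{true}$; $\neg,\wedge$ as usual; $(M,w)\models K_i\alpha$ iff $(M,w')\models\alpha$ for all $w'$ with $w\mathcal{K}_iw'$; $(M,w)\models C_\Delta\alpha$ iff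 $(M,w')\models\alpha$ for all $w'$ with $(w,w')$ in the transitive closure of $\bigcup_{i\in\Delta}\mathcal{K}_i$; $(M,w)\models[\varphi]\psi$ iff $(M,w)\models\varphi$ implies $(M|_\varphi,w)\models\psi$, where $M|_\varphi$ is the restriction of $M$ (worlds, $\pi$ and all $\mathcal{K}_i$) to the set of worlds $\{w\in W\mid(M,w)\models\varphi\}$. Knowledge structures. A truth assignment over $V$ is identified with a subset of $V$. A knowledge structure with $n$ agents is $\mathcal{F}=(V,\Gamma,O_1,\dots,O_n)$ with $V$ a set of propositional variables, $\Gamma$ a consistent set of propositional formulas over $V$, and $O_i\subseteq V$. A state of $\mathcal{F}$ is an assignment $s\subseteq V$ satisfying $\Gamma$. $(\mathcal{F},s)\models p$ iff $p\in s$; $\neg,\wedge$ as usual; $(\mathcal{F},s)\models K_i\alpha$ iff $(\mathcal{F},s')\models\alpha$ for all states $s'$ with $s'\cap O_i=s\cap O_i$; $(\mathcal{F},s)\models C_\Delta\alpha$ iff $(\mathcal{F},s')\models\alpha$ for all states $s'$ with $(s,s')\in\mathcal{E}^*_{\mathcal{V}_\Delta}$, where $\mathcal{E}^*_{\mathcal{V}_\Delta}$ is the transitive closure of the relation $\mathcal{E}_{\mathcal{V}_\Delta}$ on states given by $(s,s')\in\mathcal{E}_{\mathcal{V}_\Delta}$ iff $s\cap O_i=s'\cap O_i$ for some $i\in\Delta$. For finite variable set $V$: $(\mathcal{F},s)\models[\varphi]\psi$ iff $(\mathcal{F},s)\models\varphi$ implies $(\mathcal{F}|_\varphi,s)\models\psi$,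 where $\mathcal{F}|_\varphi=(V,\{\theta\},O_1,\dots,O_n)$ and $\theta$ is a propositional formula over $V$ satisfied by exactly those assignments $s$ that are states of $\mathcal{F}$ with $(\mathcal{F},s)\models\varphi$. $M(\mathcal{F})=(W,\pi,\mathcal{K}_1,\dots,\mathcal{K}_n)$ is the Kripke structure in which $W$ is the set of states of $\mathcal{F}$, $\pi(w)$ is the assignment $w$ itself, and $w\mathcal{K}_iw'$ iff $w\cap O_i=w'\cap O_i$. -}

module Defs where

open import Data.Fin.Base using (Fin; _↑ˡ_)
open import Data.Fin.Subset using (Subset; _∈_; _∩_)
open import Data.Irrelevant using ([_])
open import Data.Nat.Base using (ℕ; _+_)
open import Data.Product.Base using (∃; ∃-syntax; Σ-syntax; _×_; _,_)
open import Data.Refinement using (Refinement-syntax; value; _,_)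
open import Data.Unit.Base using (⊤)
open import Function.Base using (_on_)
open import Function.Bundles using (_⇔_; _↔_; Equivalence)
open import Level using (0ℓ) renaming (suc to lsuc)
open import Relation.Binary.Construct.Closure.Transitive using (TransClosure)
open import Relation.Binary.Core using (Rel)
open import Relation.Binary.PropositionalEquality.Core using (_≡_; refl)
open import Relation.Binary.Structures using (IsEquivalence)
open import Relation.Nullary.Negation.Core using (¬_)
open import Relation.Unary using (Pred; ｛_｝)

-- Throughout, n is the number of agents and m the number of propositional
-- variables: agents are Fin n, variables are V = Fin m.

private
  variable
    n m : ℕ

infixr 6 _∧_
infix  7 ¬′_

data PAL (n m : ℕ) : Set where
  var  : Fin m → PAL n m
  ¬′_  : PAL n m → PAL n m
  _∧_  : PAL n m → PAL n m → PAL n m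
  K    : Fin n → PAL n m → PAL n m
  C    : Subset n → PAL n m → PAL n m
  ⟦_⟧_ : PAL n m → PAL n m → PAL n m

-- A formula over V read as a formula over the larger variable set
-- Fin (m + k), whose first m elements are V.

extend : ∀ k → PAL n m → PAL n (m + k)
extend k (var p)   = var (p ↑ˡ k)
extend k (¬′ α)    = ¬′ extend k α
extend k (α ∧ β)   = extend k α ∧ extend k β
extend k (K i α)   = K i (extend k α)
extend k (C Δ α)   = C Δ (extend k α)
extend k (⟦ φ ⟧ ψ) = ⟦ extend k φ ⟧ extend k ψ

⋃[_]_ : {A : Set} → Subset n → (Fin n → Rel A 0ℓ) → Rel A 0ℓ
(⋃[ Δ ] R) x y = ∃[ i ] i ∈ Δ × R i x y

------------------------------------------------------------------------
-- Kripke structures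

record KripkeStructure (n m : ℕ) : Set (lsuc 0ℓ) where
  field
    World : Set
    π     : World → Subset m
    𝒦     : Fin n → Rel World 0ℓ

open KripkeStructure public

IsS5 : KripkeStructure n m → Set
IsS5 M = ∀ i → IsEquivalence (𝒦 M i)

IsFinite : KripkeStructure n m → Set
IsFinite M = ∃[ k ] (World M ↔ Fin k)

-- Worlds of the restriction carry an irrelevant membership proof, so that
-- they form a genuine subset of the worlds of M, without duplicates.

_↾_ : (M : KripkeStructure n m) → Pred (World M) 0ℓ → KripkeStructure n m
M ↾ P = record
  { World = [ w ∈ World M ∣ P w ]
  ; π     = λ w → π M (value w)
  ; 𝒦     = λ i → 𝒦 M i on value
  }

⟨_,_⟩⊨ᴷ_ : (M : KripkeStructure n m) → World M → PAL n m → Set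
⟨ M , w ⟩⊨ᴷ var p     = p ∈ π M w
⟨ M , w ⟩⊨ᴷ (¬′ α)    = ¬ (⟨ M , w ⟩⊨ᴷ α)
⟨ M , w ⟩⊨ᴷ (α ∧ β)   = (⟨ M , w ⟩⊨ᴷ α) × (⟨ M , w ⟩⊨ᴷ β)
⟨ M , w ⟩⊨ᴷ K i α     = ∀ w′ → 𝒦 M i w w′ → ⟨ M , w′ ⟩⊨ᴷ α
⟨ M , w ⟩⊨ᴷ C Δ α     =
  ∀ w′ → TransClosure (⋃[ Δ ] 𝒦 M) w w′ → ⟨ M , w′ ⟩⊨ᴷ α
⟨ M , w ⟩⊨ᴷ (⟦ φ ⟧ ψ) =
  (w⊨φ : ⟨ M , w ⟩⊨ᴷ φ) →
  ⟨ M ↾ (λ v → ⟨ M , v ⟩⊨ᴷ φ) , (w , [ w⊨φ ]) ⟩⊨ᴷ ψ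

------------------------------------------------------------------------
-- Propositional formulas

-- The constant true is included so that there are formulas even when
-- m = 0.

data PropFormula (m : ℕ) : Set where
  true : PropFormula m
  var  : Fin m → PropFormula m
  ¬′_  : PropFormula m → PropFormula m
  _∧_  : PropFormula m → PropFormula m → PropFormula m

infix 4 _⊨ₚ_ _⊨ₛ_

_⊨ₚ_ : Subset m → PropFormula m → Set
s ⊨ₚ true  = ⊤
s ⊨ₚ var p = p ∈ s
s ⊨ₚ ¬′ γ  = ¬ (s ⊨ₚ γ)
s ⊨ₚ γ ∧ δ = (s ⊨ₚ γ) × (s ⊨ₚ δ)

_⊨ₛ_ : Subset m → Pred (PropFormula m) 0ℓ → Set
s ⊨ₛ Γ = ∀ γ → Γ γ → s ⊨ₚ γ

------------------------------------------------------------------------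
-- Knowledge structures

record KnowledgeStructure (n m : ℕ) : Set (lsuc 0ℓ) where
  field
    Γ          : Pred (PropFormula m) 0ℓ
    consistent : ∃[ s ] s ⊨ₛ Γ
    O          : Fin n → Subset m

open KnowledgeStructure public

State : KnowledgeStructure n m → Set
State {m = m} F = [ s ∈ Subset m ∣ s ⊨ₛ Γ F ]

SameObs : (F : KnowledgeStructure n m) → Fin n → Rel (State F) 0ℓ
SameObs F i s s′ = value s ∩ O F i ≡ value s′ ∩ O F i

ℰ : (F : KnowledgeStructure n m) → Subset n → Rel (State F) 0ℓ
ℰ F Δ = ⋃[ Δ ] SameObs F

-- θ is satisfied by exactly those assignments that are states of F in P.

Describes : (F : KnowledgeStructure n m) →
            PropFormula m → Pred (State F) 0ℓ → Set
Describes F θ P = ∀ t → (t ⊨ₚ θ) ⇔ (Σ[ t′ ∈ State F ] value t′ ≡ t × P t′)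

singleton-⊨ : {s : Subset m} {θ : PropFormula m} → s ⊨ₚ θ → s ⊨ₛ ｛ θ ｝
singleton-⊨ s⊨θ _ refl = s⊨θ

_with-theory_consistent-by_ :
  KnowledgeStructure n m → (θ : PropFormula m) → ∃ (_⊨ₚ θ) →
  KnowledgeStructure n m
F with-theory θ consistent-by (s , s⊨θ) = record
  { Γ          = ｛ θ ｝
  ; consistent = s , singleton-⊨ s⊨θ
  ; O          = O F
  }

-- In the announcement clause, θ is determined only up to logical
-- equivalence, on which the truth of ψ does not depend; classically such a
-- θ always exists, since there are finitely many variables.

⟨_,_⟩⊨_ : (F : KnowledgeStructure n m) → State F → PAL n m → Set
⟨ F , s ⟩⊨ var p     = p ∈ value s
⟨ F , s ⟩⊨ (¬′ α)    = ¬ (⟨ F , s ⟩⊨ α)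
⟨ F , s ⟩⊨ (α ∧ β)   = (⟨ F , s ⟩⊨ α) × (⟨ F , s ⟩⊨ β)
⟨ F , s ⟩⊨ K i α     = ∀ s′ → SameObs F i s′ s → ⟨ F , s′ ⟩⊨ α
⟨ F , s ⟩⊨ C Δ α     = ∀ s′ → TransClosure (ℰ F Δ) s s′ → ⟨ F , s′ ⟩⊨ α
⟨ F , s ⟩⊨ (⟦ φ ⟧ ψ) =
  (s⊨φ : ⟨ F , s ⟩⊨ φ) →
  Σ[ θ ∈ PropFormula _ ]
  Σ[ θ-desc ∈ Describes F θ (λ t → ⟨ F , t ⟩⊨ φ) ]
    let s⊨θ = Equivalence.from (θ-desc (value s)) (s , refl , s⊨φ) in
    ⟨ F with-theory θ consistent-by (value s , s⊨θ)
    , (value s , [ singleton-⊨ s⊨θ ]) ⟩⊨ ψ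

toKripke : KnowledgeStructure n m → KripkeStructure n m
toKripke F = record
  { World = State F
  ; π     = value
  ; 𝒦     = SameObs F
  }

{-# OPTIONS --safe #-}

-- Truth in a Kripke structure is invariant under bisimulation, also for
-- announcements, since a bisimulation restricts to the worlds satisfying the
-- announced formula.  For (1), if θ describes φ, then the restriction of
-- toKripke F to φ is bisimilar to toKripke of F with theory θ.  For (2),
-- every agent i gets one new variable for each world v, true at w iff w 𝒦ᵢ v,
-- and observes exactly these.  Two worlds then look the same to i iff they
-- have the same 𝒦ᵢ-class, so sending a world to its assignment is a
-- bisimulation; it need not be injective.

module Submission where

open import Defs
open import Axiom.ExcludedMiddle using (ExcludedMiddle)
import Data.Bool.Base as Bool
open import Data.Bool.Base using (Bool)
open import Data.Bool.Properties using (∧-identityʳ; ∧-zeroʳ)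
open import Data.Fin.Base using (Fin; zero; suc; _↑ˡ_; combine; remQuot)
open import Data.Fin.Properties using (_≟_; remQuot-combine)
open import Data.Fin.Subset using (Subset; inside; outside; _∈_; _∩_; ⊥)
open import Data.Fin.Subset.Properties using (drop-there; ∩-zeroʳ)
open import Data.Irrelevant using ([_])
open import Data.Nat.Base using (ℕ; zero; suc; _+_; _*_)
open import Data.Product.Base
  using (Σ-syntax; ∃-syntax; _×_; _,_; proj₁; proj₂; uncurry)
open import Data.Refinement using (value; _,_)
open import Data.Unit.Base using (tt)
open import Data.Vec.Base using ([]; _∷_; _++_; lookup; tabulate; here; there)
open import Data.Vec.Properties
  using ([]=⇒lookup; lookup⇒[]=; lookup-++ˡ; lookup∘tabulate; tabulate-cong;
         zipWith-++; ++-injectiveʳ)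
open import Function.Base using (id; _∘_)
open import Function.Bundles using (_⇔_; _↔_; mk⇔; Equivalence; Inverse)
open import Function.Construct.Composition using (_⇔-∘_)
open import Function.Construct.Symmetry using (⇔-sym)
open import Level using (0ℓ)
open import Relation.Binary.Construct.Closure.Transitive
  using (TransClosure; [_]; _∷_)
open import Relation.Binary.Core using (REL)
open import Relation.Binary.PropositionalEquality
  using (_≡_; refl; sym; trans; cong; cong₂; subst; module ≡-Reasoning)
open import Relation.Binary.Structures using (IsEquivalence)
open import Relation.Nullary.Decidable
  using (Dec; yes; no; does; does-⇔; dec-true; recompute; decidable-stable)
open import Relation.Nullary.Negation.Core using (contradiction)
open import Relation.Unary using (Pred; Decidable; ｛_｝)

open Equivalence using (to; from)

private
  variable
    n m m′ c : ℕ

-- Bisimulations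

-- Used at two maps: `id`, between structures over the same variables, and `_↑ˡ k`, where it agrees
-- with `extend k`.
rename : (Fin m → Fin m′) → PAL n m → PAL n m′
rename ρ (var p)   = var (ρ p)
rename ρ (¬′ α)    = ¬′ rename ρ α
rename ρ (α ∧ β)   = rename ρ α ∧ rename ρ β
rename ρ (K i α)   = K i (rename ρ α)
rename ρ (C Δ α)   = C Δ (rename ρ α)
rename ρ (⟦ φ ⟧ ψ) = ⟦ rename ρ φ ⟧ rename ρ ψ

rename-id : (α : PAL n m) → rename id α ≡ α
rename-id (var p)   = refl
rename-id (¬′ α)    = cong ¬′_ (rename-id α)
rename-id (α ∧ β)   = cong₂ _∧_ (rename-id α) (rename-id β)
rename-id (K i α)   = cong (K i) (rename-id α)
rename-id (C Δ α)   = cong (C Δ) (rename-id α)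
rename-id (⟦ φ ⟧ ψ) = cong₂ ⟦_⟧_ (rename-id φ) (rename-id ψ)

rename-↑ˡ : ∀ k (α : PAL n m) → rename (_↑ˡ k) α ≡ extend k α
rename-↑ˡ k (var p)   = refl
rename-↑ˡ k (¬′ α)    = cong ¬′_ (rename-↑ˡ k α)
rename-↑ˡ k (α ∧ β)   = cong₂ _∧_ (rename-↑ˡ k α) (rename-↑ˡ k β)
rename-↑ˡ k (K i α)   = cong (K i) (rename-↑ˡ k α)
rename-↑ˡ k (C Δ α)   = cong (C Δ) (rename-↑ˡ k α)
rename-↑ˡ k (⟦ φ ⟧ ψ) = cong₂ ⟦_⟧_ (rename-↑ˡ k φ) (rename-↑ˡ k ψ)

-- Atoms are compared along `ρ` only, so `N` may have further variables with arbitrary values.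
record Bisimulation (ρ : Fin m → Fin m′)
                    (M : KripkeStructure n m) (N : KripkeStructure n m′)
                    (_~_ : REL (World M) (World N) 0ℓ) : Set where
  field
    atoms : ∀ {w v} → w ~ v → ∀ p → (p ∈ π M w) ⇔ (ρ p ∈ π N v)
    forth : ∀ {i w v w′} → w ~ v → 𝒦 M i w w′ → ∃[ v′ ] 𝒦 N i v v′ × w′ ~ v′
    back  : ∀ {i w v v′} → w ~ v → 𝒦 N i v v′ → ∃[ w′ ] 𝒦 M i w w′ × w′ ~ v′

  forth⁺ : ∀ {Δ w v w′} → w ~ v → TransClosure (⋃[ Δ ] 𝒦 M) w w′ →
           ∃[ v′ ] TransClosure (⋃[ Δ ] 𝒦 N) v v′ × w′ ~ v′
  forth⁺ z [ i , i∈Δ , k ] =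
    let v′ , k′ , z′ = forth z k in v′ , [ i , i∈Δ , k′ ] , z′
  forth⁺ z ((i , i∈Δ , k) ∷ ks) =
    let _  , k′  , z′ = forth z k
        v″ , ks′ , z″ = forth⁺ z′ ks
    in  v″ , (i , i∈Δ , k′) ∷ ks′ , z″

  back⁺ : ∀ {Δ w v v′} → w ~ v → TransClosure (⋃[ Δ ] 𝒦 N) v v′ →
          ∃[ w′ ] TransClosure (⋃[ Δ ] 𝒦 M) w w′ × w′ ~ v′
  back⁺ z [ i , i∈Δ , k ] =
    let w′ , k′ , z′ = back z k in w′ , [ i , i∈Δ , k′ ] , z′
  back⁺ z ((i , i∈Δ , k) ∷ ks) =
    let _  , k′  , z′ = back z k
        w″ , ks′ , z″ = back⁺ z′ ks
    in  w″ , (i , i∈Δ , k′) ∷ ks′ , z″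

-- The matching world found before restriction survives it, being related to a world that does.
↾-bisimulation :
  {ρ : Fin m → Fin m′} {M : KripkeStructure n m} {N : KripkeStructure n m′}
  {_~_ : REL (World M) (World N) 0ℓ}
  {P : Pred (World M) 0ℓ} {Q : Pred (World N) 0ℓ} →
  Bisimulation ρ M N _~_ → (∀ {w v} → w ~ v → P w ⇔ Q v) →
  Bisimulation ρ (M ↾ P) (N ↾ Q) (λ w v → value w ~ value v)
↾-bisimulation B P⇔Q = record
  { atoms = atoms
  ; forth = λ { {w′ = w′ , [ p ]} z k →
      let v′ , k′ , z′ = forth z k in (v′ , [ to (P⇔Q z′) p ]) , k′ , z′ }
  ; back  = λ { {v′ = v′ , [ q ]} z k →
      let w′ , k′ , z′ = back z k in (w′ , [ from (P⇔Q z′) q ]) , k′ , z′ }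
  }
  where open Bisimulation B

-- Induction on `α` for all structures at once, since the announcement case moves to the
-- restrictions. For `C`, whole chains are matched.
bisimulation-invariance :
  {ρ : Fin m → Fin m′} {M : KripkeStructure n m} {N : KripkeStructure n m′}
  {_~_ : REL (World M) (World N) 0ℓ} →
  Bisimulation ρ M N _~_ → ∀ α {w v} → w ~ v →
  (⟨ M , w ⟩⊨ᴷ α) ⇔ (⟨ N , v ⟩⊨ᴷ rename ρ α)
bisimulation-invariance B (var p) z = Bisimulation.atoms B z p
bisimulation-invariance B (¬′ α) z = mk⇔ (_∘ from ih) (_∘ to ih)
  where ih = bisimulation-invariance B α z
bisimulation-invariance B (α ∧ β) z = mk⇔
  (λ (a , b) → to ihα a , to ihβ b) (λ (a , b) → from ihα a , from ihβ b)
  where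
  ihα = bisimulation-invariance B α z
  ihβ = bisimulation-invariance B β z
bisimulation-invariance B (K i α) z = mk⇔
  (λ h v′ k → let w′ , k′ , z′ = back z k in
    to (bisimulation-invariance B α z′) (h w′ k′))
  (λ h w′ k → let v′ , k′ , z′ = forth z k in
    from (bisimulation-invariance B α z′) (h v′ k′))
  where open Bisimulation B
bisimulation-invariance B (C Δ α) z = mk⇔
  (λ h v′ k → let w′ , k′ , z′ = back⁺ z k in
    to (bisimulation-invariance B α z′) (h w′ k′))
  (λ h w′ k → let v′ , k′ , z′ = forth⁺ z k in
    from (bisimulation-invariance B α z′) (h v′ k′))
  where open Bisimulation B
bisimulation-invariance B (⟦ φ ⟧ ψ) z = mk⇔
  (λ h v⊨φ → to   (ihψ z) (h (from (ihφ z) v⊨φ)))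
  (λ h w⊨φ → from (ihψ z) (h (to   (ihφ z) w⊨φ)))
  where
  -- Kept general in the worlds: the restriction needs it at every related pair, not only at `z`.
  ihφ = λ {w v} → bisimulation-invariance B φ {w} {v}
  ihψ = bisimulation-invariance (↾-bisimulation B ihφ) ψ

-- Definability of sets of assignments

weaken : PropFormula m → PropFormula (suc m)
weaken true    = true
weaken (var p) = var (suc p)
weaken (¬′ γ)  = ¬′ weaken γ
weaken (γ ∧ δ) = weaken γ ∧ weaken δ

⊨ₚ-weaken : ∀ b (t : Subset m) γ → ((b ∷ t) ⊨ₚ weaken γ) ⇔ (t ⊨ₚ γ)
⊨ₚ-weaken b t true    = mk⇔ id id
⊨ₚ-weaken b t (var p) = mk⇔ drop-there there
⊨ₚ-weaken b t (¬′ γ)  = mk⇔ (_∘ from ih) (_∘ to ih)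
  where ih = ⊨ₚ-weaken b t γ
⊨ₚ-weaken b t (γ ∧ δ) = mk⇔
  (λ (g , d) → to ihγ g , to ihδ d) (λ (g , d) → from ihγ g , from ihδ d)
  where
  ihγ = ⊨ₚ-weaken b t γ
  ihδ = ⊨ₚ-weaken b t δ

-- Shannon expansion: θ says that p₀ implies θ₁ and ¬ p₀ implies θ₀.

definable : {Q : Pred (Subset m) 0ℓ} → Decidable Q →
            Σ[ θ ∈ PropFormula m ] (∀ t → (t ⊨ₚ θ) ⇔ Q t)
definable {zero} Q? with Q? []
... | yes q = true      , λ { [] → mk⇔ (λ _ → q) (λ _ → tt) }
... | no ¬q = (¬′ true) , λ { [] → mk⇔ (λ ¬tt → contradiction tt ¬tt)
                                       (λ q → contradiction q ¬q) }
definable {suc m} {Q} Q? = θ , correct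
  where
  D₁ = definable (Q? ∘ (inside ∷_))
  D₀ = definable (Q? ∘ (outside ∷_))
  θ₁ = proj₁ D₁
  θ₀ = proj₁ D₀

  θ : PropFormula (suc m)
  θ = (¬′ (var zero ∧ ¬′ weaken θ₁)) ∧ (¬′ ((¬′ var zero) ∧ ¬′ weaken θ₀))

  correct : ∀ t → (t ⊨ₚ θ) ⇔ Q t
  correct (inside ∷ t) = mk⇔
    -- Implication is coded as `¬′ (_ ∧ ¬′ _)`; `Q?` removes the resulting double negation.
    (λ (h , _) → decidable-stable (Q? _) λ ¬q → h (here , ¬q ∘ to d))
    (λ q → (λ (_ , ¬θ₁) → ¬θ₁ (from d q)) , (λ (¬p , _) → ¬p here))
    where d = proj₂ D₁ t ⇔-∘ ⊨ₚ-weaken inside t θ₁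
  correct (outside ∷ t) = mk⇔
    (λ (_ , h) → decidable-stable (Q? _) λ ¬q → h ((λ ()) , ¬q ∘ to d))
    (λ q → (λ ()) , (λ (_ , ¬θ₀) → ¬θ₀ (from d q)))
    where d = proj₂ D₀ t ⇔-∘ ⊨ₚ-weaken outside t θ₀

-- From knowledge structures to Kripke structures

-- `P` and `Q` stand for truth of the announced formula in `F` and in `toKripke F`. Related worlds
-- carry the same assignment, so only membership proofs have to be converted.
announcement-bisimulation :
  ExcludedMiddle 0ℓ → (F : KnowledgeStructure n m) {P Q : Pred (State F) 0ℓ}
  {θ : PropFormula m} {θ-consistent : ∃[ t ] t ⊨ₚ θ} →
  (∀ t → P t ⇔ Q t) → Describes F θ P →
  Bisimulation id (toKripke (F with-theory θ consistent-by θ-consistent))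
    (toKripke F ↾ Q) (λ t u → value t ≡ value (value u))
announcement-bisimulation em F {P} {Q} {θ} P⇔Q θ-desc = record
  { atoms = λ { refl p → mk⇔ id id }
  ; forth = λ { {w′ = t , [ h ]} refl k →
      ((t , [ inΓ (to (θ-desc t) (h θ refl)) ])
      , [ inQ (to (θ-desc t) (h θ refl)) ])
      , k , refl }
  ; back  = λ { {v′ = (t , [ γ ]) , [ q ]} refl k →
      (t , [ singleton-⊨
               (from (θ-desc t) ((t , [ γ ]) , refl , from (P⇔Q _) q)) ])
      , k , refl }
  }
  where
  -- The proof that t satisfies Γ is irrelevant; excluded middle recovers it.
  inΓ : ∀ {t} → Σ[ t′ ∈ State F ] value t′ ≡ t × P t′ → t ⊨ₛ Γ F
  inΓ ((_ , [ γ ]) , refl , _) = recompute em γ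

  -- Once the equation in `e` is matched, irrelevance makes the rebuilt state definitionally equal
  -- to the one in `e`.
  inQ : ∀ {t} (e : Σ[ t′ ∈ State F ] value t′ ≡ t × P t′) → Q (t , [ inΓ e ])
  inQ (_ , refl , p) = to (P⇔Q _) p

-- Induction on `α` for all `F`, since an announcement replaces the theory.
toKripke-⊨ : ExcludedMiddle 0ℓ →
             (F : KnowledgeStructure n m) (s : State F) (α : PAL n m) →
             (⟨ F , s ⟩⊨ α) ⇔ (⟨ toKripke F , s ⟩⊨ᴷ α)
toKripke-⊨ em F s (var p) = mk⇔ id id
toKripke-⊨ em F s (¬′ α)  = mk⇔ (_∘ from ih) (_∘ to ih)
  where ih = toKripke-⊨ em F s α
toKripke-⊨ em F s (α ∧ β) = mk⇔
  (λ (a , b) → to ihα a , to ihβ b) (λ (a , b) → from ihα a , from ihβ b)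
  where
  ihα = toKripke-⊨ em F s α
  ihβ = toKripke-⊨ em F s β
toKripke-⊨ em F s (K i α) = mk⇔
  -- The two semantics of `K` pass the states to `SameObs` in opposite orders.
  (λ h t k → to   (toKripke-⊨ em F t α) (h t (sym k)))
  (λ h t k → from (toKripke-⊨ em F t α) (h t (sym k)))
toKripke-⊨ em F s (C Δ α) = mk⇔
  (λ h t k → to   (toKripke-⊨ em F t α) (h t k))
  (λ h t k → from (toKripke-⊨ em F t α) (h t k))
toKripke-⊨ {n} {m} em F s (⟦ φ ⟧ ψ) = mk⇔ ⟦⟧-to ⟦⟧-from
  where
  announced : Pred (Subset m) 0ℓ
  announced t = Σ[ t′ ∈ State F ] value t′ ≡ t × (⟨ F , t′ ⟩⊨ φ)

  ihφ = λ t → toKripke-⊨ em F t φ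

  -- Stated for every describing `θ`: one direction is handed a `θ`, the other constructs its own.
  ihψ : ∀ θ (θ-desc : Describes F θ (λ t → ⟨ F , t ⟩⊨ φ))
        {s⊨θ : value s ⊨ₚ θ} .{s⊨Γ : value s ⊨ₛ ｛ θ ｝}
        .{s⊨φ : ⟨ toKripke F , s ⟩⊨ᴷ φ} →
        (⟨ F with-theory θ consistent-by (value s , s⊨θ) , (value s , [ s⊨Γ ]) ⟩⊨ ψ)
        ⇔
        (⟨ toKripke F ↾ (λ t → ⟨ toKripke F , t ⟩⊨ᴷ φ) , (s , [ s⊨φ ]) ⟩⊨ᴷ ψ)
  ihψ θ θ-desc {s⊨θ} =
    subst (λ χ → (⟨ _ , _ ⟩⊨ᴷ ψ) ⇔ (⟨ _ , _ ⟩⊨ᴷ χ)) (rename-id ψ)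
      (bisimulation-invariance
        (announcement-bisimulation em F {θ-consistent = _ , s⊨θ} ihφ θ-desc)
        ψ refl)
    ⇔-∘ toKripke-⊨ em _ _ ψ

  ⟦⟧-to : ⟨ F , s ⟩⊨ (⟦ φ ⟧ ψ) → ⟨ toKripke F , s ⟩⊨ᴷ (⟦ φ ⟧ ψ)
  ⟦⟧-to h s⊨φ with h (from (ihφ s) s⊨φ)
  ... | θ , θ-desc , s⊨ψ = to (ihψ θ θ-desc) s⊨ψ

  ⟦⟧-from : ⟨ toKripke F , s ⟩⊨ᴷ (⟦ φ ⟧ ψ) → ⟨ F , s ⟩⊨ (⟦ φ ⟧ ψ)
  ⟦⟧-from h s⊨φ =
    -- Excluded middle decides `announced`, which makes it definable.
    let θ , θ-desc = definable {Q = announced} (λ _ → em) in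
    θ , θ-desc , from (ihψ θ θ-desc) (h (to (ihφ s) s⊨φ))

-- From Kripke structures to knowledge structures

-- A flattened grid: `combine i j` is the variable of agent `i` for world `j`.
block : (Fin n → Fin c → Bool) → Subset (n * c)
block {c = c} f = tabulate (uncurry f ∘ remQuot c)

lookup-block : ∀ (f : Fin n → Fin c → Bool) i j →
               lookup (block f) (combine i j) ≡ f i j
lookup-block f i j = trans (lookup∘tabulate _ (combine i j))
                           (cong (uncurry f) (remQuot-combine i j))

block-cong : {f g : Fin n → Fin c → Bool} →
             (∀ i j → f i j ≡ g i j) → block f ≡ block g
block-cong f≗g = tabulate-cong λ x → f≗g _ _

tabulate-∩ : (f g : Fin m → Bool) →
             tabulate f ∩ tabulate g ≡ tabulate (λ x → f x Bool.∧ g x)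
tabulate-∩ {zero}  f g = refl
tabulate-∩ {suc m} f g =
  cong (f zero Bool.∧ g zero ∷_) (tabulate-∩ (f ∘ suc) (g ∘ suc))

module _ (em : ExcludedMiddle 0ℓ) (M : KripkeStructure n m)
         (World↔ : World M ↔ Fin c) (s5 : IsS5 M) where

  private
    open module World↔ = Inverse World↔ using ()
      renaming (to to index; from to world)
    module S5 i = IsEquivalence (s5 i)

  class : World M → Fin n → Fin c → Bool
  class w i j = does (em {𝒦 M i w (world j)})

  class-cong : ∀ {i w w′} → 𝒦 M i w w′ → ∀ j → class w i j ≡ class w′ i j
  class-cong {i} k j =
    does-⇔ (mk⇔ (S5.trans i (S5.sym i k)) (S5.trans i k)) em em

  -- By reflexivity `w′` lies in its own class, hence in that of `w`; the equality is evaluated at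
  -- the index of `w′`.
  class-injective : ∀ {i w w′} → (∀ j → class w i j ≡ class w′ i j) →
                    𝒦 M i w w′
  class-injective {i} {w} {w′} eq =
    subst (𝒦 M i w) (World↔.strictlyInverseʳ w′)
      (related em (trans (eq (index w′)) (dec-true em reflexive)))
    where
    reflexive : 𝒦 M i w′ (world (index w′))
    reflexive = S5.reflexive i (sym (World↔.strictlyInverseʳ w′))

    related : ∀ {A : Set} (A? : Dec A) → does A? ≡ Bool.true → A
    related (yes a) _ = a

  encode : World M → Subset (m + n * c)
  encode w = π M w ++ block (class w)

  observed : Fin n → Subset (m + n * c)
  observed i = ⊥ ++ block (λ i′ _ → does (i′ ≟ i))

  -- The intersection splits along `++`: the part over the original variables vanishes, and in the
  -- block only the row of agent `i` survives.
  encode-∩-observed : ∀ w i → encode w ∩ observed i ≡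
    ⊥ {m} ++ block (λ i′ j → class w i′ j Bool.∧ does (i′ ≟ i))
  encode-∩-observed w i =
    trans (zipWith-++ Bool._∧_ (π M w) (block (class w)) ⊥ _)
          (cong₂ _++_ (∩-zeroʳ (π M w)) (tabulate-∩ _ _))

  -- Row `i` of the masked block is the class of the world and all other rows are false, so equal
  -- observations mean equal classes.
  observation⇔𝒦 : ∀ i w w′ →
    (encode w ∩ observed i ≡ encode w′ ∩ observed i) ⇔ 𝒦 M i w w′
  observation⇔𝒦 i w w′ = mk⇔
    (λ eq → class-injective λ j → begin
      class w i j                             ≡⟨ masked w j ⟨
      lookup (block (mask w)) (combine i j)   ≡⟨ cong (λ b → lookup b (combine i j))
                                                   (mask-≡ eq) ⟩
      lookup (block (mask w′)) (combine i j)  ≡⟨ masked w′ j ⟩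
      class w′ i j                            ∎)
    (λ k → begin
      encode w ∩ observed i     ≡⟨ encode-∩-observed w i ⟩
      ⊥ {m} ++ block (mask w)   ≡⟨ cong (⊥ {m} ++_) (block-cong (mask-cong k)) ⟩
      ⊥ {m} ++ block (mask w′)  ≡⟨ encode-∩-observed w′ i ⟨
      encode w′ ∩ observed i    ∎)
    where
    open ≡-Reasoning

    mask : World M → Fin n → Fin c → Bool
    mask u i′ j = class u i′ j Bool.∧ does (i′ ≟ i)

    masked : ∀ u j → lookup (block (mask u)) (combine i j) ≡ class u i j
    masked u j = begin
      lookup (block (mask u)) (combine i j)  ≡⟨ lookup-block (mask u) i j ⟩
      class u i j Bool.∧ does (i ≟ i)        ≡⟨ cong (class u i j Bool.∧_)
                                                  (dec-true (i ≟ i) refl) ⟩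
      class u i j Bool.∧ Bool.true           ≡⟨ ∧-identityʳ _ ⟩
      class u i j                            ∎

    mask-≡ : encode w ∩ observed i ≡ encode w′ ∩ observed i →
             block (mask w) ≡ block (mask w′)
    mask-≡ eq = ++-injectiveʳ (⊥ {m}) ⊥ (begin
      ⊥ {m} ++ block (mask w)   ≡⟨ encode-∩-observed w i ⟨
      encode w ∩ observed i     ≡⟨ eq ⟩
      encode w′ ∩ observed i    ≡⟨ encode-∩-observed w′ i ⟩
      ⊥ {m} ++ block (mask w′)  ∎)

    mask-cong : 𝒦 M i w w′ → ∀ i′ j → mask w i′ j ≡ mask w′ i′ j
    mask-cong k i′ j with i′ ≟ i
    ... | yes refl = cong (Bool._∧ Bool.true) (class-cong k j)
    ... | no _     = trans (∧-zeroʳ _) (sym (∧-zeroʳ _))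

  encodings : Σ[ θ ∈ PropFormula (m + n * c) ]
              (∀ t → (t ⊨ₚ θ) ⇔ (∃[ w ] encode w ≡ t))
  encodings = definable λ _ → em

  encode-⊨ : ∀ w → encode w ⊨ₚ proj₁ encodings
  encode-⊨ w = from (proj₂ encodings (encode w)) (w , refl)

  -- The world `w` witnesses consistency; theory and observables are the same for every `w`.
  knowledgeStructure : World M → KnowledgeStructure n (m + n * c)
  knowledgeStructure w = record
    { Γ          = ｛ proj₁ encodings ｝
    ; consistent = encode w , singleton-⊨ (encode-⊨ w)
    ; O          = observed
    }

  encode-bisimulation : ∀ w → Bisimulation (_↑ˡ (n * c)) M
    (toKripke (knowledgeStructure w)) (λ v s → encode v ≡ value s)
  encode-bisimulation w = record
    { atoms = λ { {v} refl p →
        let eq = lookup-++ˡ (π M v) (block (class v)) p in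
        mk⇔ (λ p∈ → lookup⇒[]= _ _ (trans eq ([]=⇒lookup p∈)))
            (λ p∈ → lookup⇒[]= _ _ (trans (sym eq) ([]=⇒lookup p∈))) }
    ; forth = λ { {w′ = v′} refl k →
        (encode v′ , [ singleton-⊨ (encode-⊨ v′) ])
        , from (observation⇔𝒦 _ _ v′) k , refl }
    ; back  = λ { {w = v} {v′ = t , [ h ]} refl k →
        -- `h` is irrelevant, so excluded middle is needed to obtain an actual world encoded by `t`.
        let v′ , eq = recompute em (to (proj₂ encodings t) (h _ refl)) in
        v′ , to (observation⇔𝒦 _ v v′) (trans k (cong (_∩ _) (sym eq))) , eq }
    }

proposition28 : ExcludedMiddle 0ℓ →
    (∀ (n m : ℕ) (F : KnowledgeStructure n m) (s : State F) (α : PAL n m) →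
    (⟨ F , s ⟩⊨ α) ⇔ (⟨ toKripke F , s ⟩⊨ᴷ α))
    ×
    (∀ (n m : ℕ) (M : KripkeStructure n m) → IsFinite M → IsS5 M →
    (w : World M) →
    ∃[ k ] Σ[ F ∈ KnowledgeStructure n (m + k) ] Σ[ s ∈ State F ]
    (∀ (α : PAL n m) →
    (⟨ F , s ⟩⊨ extend k α) ⇔ (⟨ M , w ⟩⊨ᴷ α)))
proposition28 em =
  (λ _ _ → toKripke-⊨ em) ,
  λ n m M (c , World↔) s5 w →
    let F = knowledgeStructure em M World↔ s5 w
        s = encode em M World↔ s5 w , [ singleton-⊨ (encode-⊨ em M World↔ s5 w) ]
        B = encode-bisimulation em M World↔ s5 w
    in n * c , F , s , λ α →
      -- Part (1) leads from `F` to its Kripke structure, and the bisimulation from there back to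
      -- `M`.
      ⇔-sym (subst (λ χ → (⟨ M , w ⟩⊨ᴷ α) ⇔ (⟨ toKripke F , s ⟩⊨ᴷ χ))
              (rename-↑ˡ _ α) (bisimulation-invariance B α refl))
      ⇔-∘ toKripke-⊨ em F s (extend _ α)
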